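{- Let $H$ be a graph with an optimal vector coloring $i\mapsto p_i$, and let $G$ be a graph with $H\subseteq G\subseteq H'(p)$ (all three graphs having vertex set $V(H)$). Then: (i) $i\mapsto p_i$ is an optimal vector coloring of $G$; in particular $\chi_v(H)=\chi_v(G)$. (ii) If $H$ is uniquely vector colorable, then $G$ is uniquely vector colorable, and $i\mapsto p_i$ is the unique optimal vector coloring of $G$ (up to equality of Gram matrices). Moreover, if $\langle p_i,p_j\rangle<-1/(\chi_v(G)-1)$ for some edge $i\sim_G j$, then the optimal vector coloring $i\mapsto p_i$ is not strict for $G$, and thus $\chi_v(G)<\chi_{sv}(G)$.
   Context: A vector $t$-coloring of a graph $G$ ($t\ge2$) is an assignment $i\mapsto p_i$ of unit vectors in some $\mathbb{R}^d$ to $V(G)$ with $\langle p_i,p_j\rangle\le -1/(t-1)$ whenever $i\sim j$; it is strict if equality holds for every edge. $\chi_v(G)$ (resp. $\chi_{sv}(G)$) is the smallest $t\ge 2$ for which a (resp. strict) vector $t$-coloring exists; a vector $\chi_v(G)$-coloring is optimal. $G$ is uniquely vector colorable if any two optimal vector colorings of $G$ have equal Gram matrices. For an optimal vector coloring $i\mapsto p_i$ of $H$, $H'(p)$ is the graph with vertex set $V(H)$ in which distinct $u,v$ are adjacent iff $\langle p_u,p_v\rangle\le -1/(\chi_v(H)-1)$. Subgraph inclusion $H\subseteq G$ means every edge of $H$ is an edge of $G$. -}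

module Defs where

open import Algebra.Bundles using (CommutativeRing)
import Algebra.Properties.Semiring.Sum as SemiringSum
open import Data.Fin.Base using (Fin)
open import Data.Nat.Base using (ℕ)
open import Data.Product.Base using (Σ; ∃; _×_; _,_)
open import Data.Vec.Functional using (Vector; zipWith)
open import Level using (Level; _⊔_; suc)
open import Relation.Binary.Core using (Rel)
open import Relation.Binary.Definitions using (Symmetric; Irreflexive)
import Relation.Binary.Construct.StrictToNonStrict as StrictToNonStrict
open import Relation.Binary.PropositionalEquality as ≡ using (_≡_; _≢_)
open import Relation.Binary.Structures using (IsStrictTotalOrder; IsTotalOrder)
open import Relation.Unary using (Pred)

-- The real numbers, axiomatised as a Dedekind-complete ordered field.  These
-- axioms are categorical; trichotomy together with suprema of arbitrary
-- predicates makes this the classical real line.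
record RealNumbers c ℓ₁ ℓ₂ : Set (suc (c ⊔ ℓ₁ ⊔ ℓ₂)) where
  infix 4 _<_
  infix 8 1/_[_]
  field
    commutativeRing : CommutativeRing c ℓ₁

  open CommutativeRing commutativeRing public

  field
    _<_                : Rel Carrier ℓ₂
    isStrictTotalOrder : IsStrictTotalOrder _≈_ _<_

  open StrictToNonStrict _≈_ _<_ public using (_≤_)

  UpperBound : ∀ {ℓ} → Pred Carrier ℓ → Pred Carrier (c ⊔ ℓ₁ ⊔ ℓ₂ ⊔ ℓ)
  UpperBound P u = ∀ {x} → P x → x ≤ u

  field
    0<1        : 0# < 1#
    +-monoˡ-<  : ∀ z {x y} → x < y → x + z < y + z
    *-positive : ∀ {x y} → 0# < x → 0# < y → 0# < x * y

    1/_[_]     : (x : Carrier) → .(x ≉ 0#) → Carrier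
    *-inverseʳ : ∀ x .(x≉0 : x ≉ 0#) → x * 1/ x [ x≉0 ] ≈ 1#

    supremum   : (P : Pred Carrier (c ⊔ ℓ₁ ⊔ ℓ₂)) → ∃ P → ∃ (UpperBound P) →
                 ∃ λ s → UpperBound P s × (∀ {u} → UpperBound P u → s ≤ u)

  2# : Carrier
  2# = 1# + 1#

  ≤-isTotalOrder : IsTotalOrder _≈_ _≤_
  ≤-isTotalOrder = StrictToNonStrict.isTotalOrder _≈_ _<_ isStrictTotalOrder

record Graph (n : ℕ) (a : Level) : Set (suc a) where
  field
    Adj        : Rel (Fin n) a
    adj-sym    : Symmetric Adj
    adj-irrefl : Irreflexive _≡_ Adj

open Graph public

infix 4 _⊆_
_⊆_ : ∀ {n a b} → Graph n a → Graph n b → Set (a ⊔ b)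
H ⊆ G = ∀ {i j} → Adj H i j → Adj G i j

module VectorColoring {c ℓ₁ ℓ₂} (ℝ : RealNumbers c ℓ₁ ℓ₂) where

  open RealNumbers ℝ
  open SemiringSum semiring using (sum; sum-cong-≋)
  private
    module < = IsStrictTotalOrder isStrictTotalOrder
    module ≤ = IsTotalOrder ≤-isTotalOrder

  ℝ^_ : ℕ → Set c
  ℝ^ d = Vector Carrier d

  ⟨_,_⟩ : ∀ {d} → ℝ^ d → ℝ^ d → Carrier
  ⟨ x , y ⟩ = sum (zipWith _*_ x y)

  ⟨,⟩-comm : ∀ {d} (x y : ℝ^ d) → ⟨ x , y ⟩ ≈ ⟨ y , x ⟩
  ⟨,⟩-comm x y = sum-cong-≋ λ k → *-comm (x k) (y k)

  2≤t⇒t-1≉0 : ∀ {t} → 2# ≤ t → t - 1# ≉ 0#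
  2≤t⇒t-1≉0 {t} 2≤t t-1≈0 = <.irrefl refl (StrictToNonStrict.<-≤-trans _≈_ _<_ <.trans <.<-respʳ-≈ 1<2 2≤1)
    where
    1<2 : 1# < 2#
    1<2 = <.<-respˡ-≈ (+-identityˡ 1#) (+-monoˡ-< 1# 0<1)

    t≈1 : t ≈ 1#
    t≈1 = trans (sym (+-identityʳ t))
          (trans (+-congˡ (sym (-‿inverseˡ 1#)))
          (trans (sym (+-assoc t (- 1#) 1#))
          (trans (+-congʳ t-1≈0) (+-identityˡ 1#))))

    2≤1 : 2# ≤ 1#
    2≤1 = ≤.≤-respʳ-≈ t≈1 2≤t

  -1/[_-1] : (t : Carrier) → .(2# ≤ t) → Carrier
  -1/[ t -1] 2≤t = - 1/ (t - 1#) [ 2≤t⇒t-1≉0 2≤t ]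

  -- Unit vectors are specified by ⟨ p i , p i ⟩ ≈ 1#, which avoids square roots.
  record IsVectorColoring {n a} (G : Graph n a) (t : Carrier)
                          {d} (p : Fin n → ℝ^ d) : Set (a ⊔ ℓ₁ ⊔ ℓ₂) where
    field
      2≤t       : 2# ≤ t
      unit      : ∀ i → ⟨ p i , p i ⟩ ≈ 1#
      separated : ∀ {i j} → Adj G i j → ⟨ p i , p j ⟩ ≤ -1/[ t -1] 2≤t

  record IsStrictVectorColoring {n a} (G : Graph n a) (t : Carrier)
                                {d} (p : Fin n → ℝ^ d) : Set (a ⊔ ℓ₁ ⊔ ℓ₂) where
    field
      isVectorColoring : IsVectorColoring G t p

    open IsVectorColoring isVectorColoring public

    field
      tight : ∀ {i j} → Adj G i j → ⟨ p i , p j ⟩ ≈ -1/[ t -1] 2≤t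

  VectorColorable : ∀ {n a} → Graph n a → Pred Carrier (c ⊔ ℓ₁ ⊔ ℓ₂ ⊔ a)
  VectorColorable {n} G t = Σ ℕ λ d → Σ (Fin n → ℝ^ d) (IsVectorColoring G t)

  StrictlyVectorColorable : ∀ {n a} → Graph n a → Pred Carrier (c ⊔ ℓ₁ ⊔ ℓ₂ ⊔ a)
  StrictlyVectorColorable {n} G t = Σ ℕ λ d → Σ (Fin n → ℝ^ d) (IsStrictVectorColoring G t)

  IsLeast : ∀ {ℓ} → Pred Carrier ℓ → Pred Carrier (c ⊔ ℓ₁ ⊔ ℓ₂ ⊔ ℓ)
  IsLeast P t = P t × (∀ {s} → P s → t ≤ s)

  -- χᵥ and χₛᵥ are relations rather than functions, since that the minimum is
  -- attained is not proved here; t Isχᵥ G reads "t = χᵥ(G)".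
  infix 4 _Isχᵥ_ _Isχₛᵥ_
  _Isχᵥ_ : ∀ {n a} → Carrier → Graph n a → Set (c ⊔ ℓ₁ ⊔ ℓ₂ ⊔ a)
  t Isχᵥ G = IsLeast (VectorColorable G) t

  _Isχₛᵥ_ : ∀ {n a} → Carrier → Graph n a → Set (c ⊔ ℓ₁ ⊔ ℓ₂ ⊔ a)
  t Isχₛᵥ G = IsLeast (StrictlyVectorColorable G) t

  record IsOptimal {n a} (G : Graph n a) {d} (p : Fin n → ℝ^ d) : Set (c ⊔ ℓ₁ ⊔ ℓ₂ ⊔ a) where
    field
      χᵥ               : Carrier
      isχᵥ             : χᵥ Isχᵥ G
      isVectorColoring : IsVectorColoring G χᵥ p

    open IsVectorColoring isVectorColoring public

    threshold : Carrier
    threshold = -1/[ χᵥ -1] 2≤t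

  _≈Gram_ : ∀ {n d e} → (Fin n → ℝ^ d) → (Fin n → ℝ^ e) → Set ℓ₁
  p ≈Gram q = ∀ i j → ⟨ p i , p j ⟩ ≈ ⟨ q i , q j ⟩

  UniquelyVectorColorable : ∀ {n a} → Graph n a → Set (c ⊔ ℓ₁ ⊔ ℓ₂ ⊔ a)
  UniquelyVectorColorable {n} G =
    ∀ {d e} (p : Fin n → ℝ^ d) (q : Fin n → ℝ^ e) → IsOptimal G p → IsOptimal G q → p ≈Gram q

  -- H′(p), for an optimal vector coloring p of H.
  _′[_] : ∀ {n a} (H : Graph n a) {d} {p : Fin n → ℝ^ d} → IsOptimal H p → Graph n (ℓ₁ ⊔ ℓ₂)
  _′[_] H {p = p} opt = record
    { Adj        = λ u v → u ≢ v × ⟨ p u , p v ⟩ ≤ IsOptimal.threshold opt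
    ; adj-sym    = λ {u} {v} (u≢v , le) → ≡.≢-sym u≢v , ≤.≤-respˡ-≈ (⟨,⟩-comm (p u) (p v)) le
    ; adj-irrefl = λ u≡v (u≢v , _) → u≢v u≡v
    }

{-# OPTIONS --safe #-}
module Submission where

open import Data.Fin.Base using (Fin)
open import Data.Nat.Base using (ℕ)
open import Data.Product.Base using (∃₂; _×_; _,_; proj₁; proj₂)
open import Data.Sum.Base using (inj₁; inj₂)
open import Relation.Binary.Structures using (IsStrictTotalOrder; IsTotalOrder)
open import Relation.Nullary.Negation using (¬_; contradiction)
open import Relation.Unary using (Pred) renaming (_⊆_ to _⊆ᵖ_)
import Relation.Binary.Reasoning.Setoid as SetoidReasoning
open import Defs

-- A vector t-coloring of G is one of H because H ⊆ G, while p colors G at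
-- χᵥ(H) because G ⊆ H′(p).  Hence χᵥ(G) = χᵥ(H), and every optimal coloring of G
-- is an optimal coloring of H, so uniqueness descends from H to G.  If
-- χₛᵥ(G) = χᵥ(G), an optimal strict coloring has the Gram matrix of p, which
-- then cannot have an entry below the threshold at an edge.

module RealNumbersProperties {c ℓ₁ ℓ₂} (ℝ : RealNumbers c ℓ₁ ℓ₂) where

  open RealNumbers ℝ
  open SetoidReasoning setoid

  module < = IsStrictTotalOrder isStrictTotalOrder
  module ≤ = IsTotalOrder ≤-isTotalOrder

  -- Multiplicative inverses are unique: insert `y * y⁻¹`, replace this `y` by `x`, and cancel
  -- `x⁻¹ * x`.
  1/-cong : ∀ {x y} .(x≉0 : x ≉ 0#) .(y≉0 : y ≉ 0#) → x ≈ y → 1/ x [ x≉0 ] ≈ 1/ y [ y≉0 ]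
  1/-cong {x} {y} x≉0 y≉0 x≈y = begin
    x⁻¹              ≈⟨ *-identityʳ x⁻¹ ⟨
    x⁻¹ * 1#         ≈⟨ *-congˡ (*-inverseʳ y y≉0) ⟨
    x⁻¹ * (y * y⁻¹)  ≈⟨ *-assoc x⁻¹ y y⁻¹ ⟨
    x⁻¹ * y * y⁻¹    ≈⟨ *-congʳ (*-congˡ x≈y) ⟨
    x⁻¹ * x * y⁻¹    ≈⟨ *-congʳ (trans (*-comm x⁻¹ x) (*-inverseʳ x x≉0)) ⟩
    1# * y⁻¹         ≈⟨ *-identityˡ y⁻¹ ⟩
    y⁻¹              ∎
    where
    x⁻¹ = 1/ x [ x≉0 ]
    y⁻¹ = 1/ y [ y≉0 ]

module VectorColoringProperties {c ℓ₁ ℓ₂} (ℝ : RealNumbers c ℓ₁ ℓ₂) where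

  open RealNumbers ℝ
  open RealNumbersProperties ℝ
  open VectorColoring ℝ

  -1/[-1]-cong : ∀ {s t} .(2≤s : 2# ≤ s) .(2≤t : 2# ≤ t) → s ≈ t → -1/[ s -1] 2≤s ≈ -1/[ t -1] 2≤t
  -1/[-1]-cong 2≤s 2≤t s≈t =
    -‿cong (1/-cong (2≤t⇒t-1≉0 2≤s) (2≤t⇒t-1≉0 2≤t) (+-congʳ s≈t))

  module _ {p q} {P : Pred Carrier p} {Q : Pred Carrier q} where

    IsLeast-antitone : Q ⊆ᵖ P → ∀ {s t} → IsLeast P s → IsLeast Q t → s ≤ t
    IsLeast-antitone Q⊆P (_ , s≤P) (Qt , _) = s≤P (Q⊆P Qt)

    -- A lower bound of `P` also bounds the smaller `Q`, so only attainment in `Q` has to be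
    -- supplied.
    IsLeast-⊆ : Q ⊆ᵖ P → ∀ {t} → Q t → IsLeast P t → IsLeast Q t
    IsLeast-⊆ Q⊆P Qt (_ , t≤P) = Qt , λ Qs → t≤P (Q⊆P Qs)

  IsLeast-unique : ∀ {ℓ} {P : Pred Carrier ℓ} {s t} → IsLeast P s → IsLeast P t → s ≈ t
  IsLeast-unique (Ps , s≤P) (Pt , t≤P) = ≤.antisym (s≤P Pt) (t≤P Ps)

  -- `P` is not assumed to respect `≈`, so `P t` is a separate hypothesis; in use, a coloring at `t`
  -- itself provides it.
  IsLeast-resp-≈ : ∀ {ℓ} {P : Pred Carrier ℓ} {s t} → s ≈ t → P t → IsLeast P s → IsLeast P t
  IsLeast-resp-≈ s≈t Pt (_ , s≤P) = Pt , λ Pu → ≤.≤-respˡ-≈ s≈t (s≤P Pu)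

  module _ {n a b} {H : Graph n a} {G : Graph n b} (H⊆G : H ⊆ G) where

    restrict : ∀ {t d} {p : Fin n → ℝ^ d} → IsVectorColoring G t p → IsVectorColoring H t p
    restrict col = record
      { 2≤t       = 2≤t
      ; unit      = unit
      ; separated = λ i∼j → separated (H⊆G i∼j)
      }
      where open IsVectorColoring col

    colorable-⊆ : VectorColorable G ⊆ᵖ VectorColorable H
    colorable-⊆ (d , p , col) = d , p , restrict col

    module _ {d} {p : Fin n → ℝ^ d} (opt : IsOptimal H p) (G⊆H′ : G ⊆ (H ′[ opt ])) where

      private module opt = IsOptimal opt

      extend : IsVectorColoring G opt.χᵥ p
      extend = record
        { 2≤t       = opt.2≤t
        ; unit      = opt.unit
        -- The second component of adjacency in `H ′[ opt ]` is exactly the separation inequality at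
        -- `opt.χᵥ`.
        ; separated = λ i∼j → proj₂ (G⊆H′ i∼j)
        }

      extend-isχᵥ : opt.χᵥ Isχᵥ G
      extend-isχᵥ = IsLeast-⊆ colorable-⊆ (_ , _ , extend) opt.isχᵥ

      extend-isOptimal : IsOptimal G p
      extend-isOptimal = record
        { χᵥ               = opt.χᵥ
        ; isχᵥ             = extend-isχᵥ
        ; isVectorColoring = extend
        }

      χᵥ-unchanged : ∀ {s t} → s Isχᵥ H → t Isχᵥ G → s ≈ t
      χᵥ-unchanged s-χᵥ t-χᵥ =
        trans (IsLeast-unique s-χᵥ opt.isχᵥ) (IsLeast-unique extend-isχᵥ t-χᵥ)

      restrict-isOptimal : ∀ {e} {q : Fin n → ℝ^ e} → IsOptimal G q → IsOptimal H q
      restrict-isOptimal {q = q} opt-q = record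
        { χᵥ               = q.χᵥ
        -- The value `q.χᵥ` is attained for `H` by restricting a coloring of `G`; minimality carries
        -- over from `opt.χᵥ`, since the two values agree.
        ; isχᵥ             = IsLeast-resp-≈ (χᵥ-unchanged opt.isχᵥ q.isχᵥ)
                               (colorable-⊆ (proj₁ q.isχᵥ)) opt.isχᵥ
        ; isVectorColoring = restrict q.isVectorColoring
        }
        where module q = IsOptimal opt-q

      restrict-unique : UniquelyVectorColorable H → UniquelyVectorColorable G
      restrict-unique uvc q r opt-q opt-r =
        uvc q r (restrict-isOptimal opt-q) (restrict-isOptimal opt-r)

  module _ {n b} {G : Graph n b} where

    strictlyColorable⇒colorable : StrictlyVectorColorable G ⊆ᵖ VectorColorable G
    strictlyColorable⇒colorable (d , p , col) =
      d , p , IsStrictVectorColoring.isVectorColoring col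

    -- The bound `2≤t` is an irrelevant argument of the threshold, so the slack inequality and
    -- `tight` refer to the same number.
    slack⇒¬strict : ∀ {t d} {p : Fin n → ℝ^ d} (2≤t : 2# ≤ t) {i j} → Adj G i j →
                    ⟨ p i , p j ⟩ < -1/[ t -1] 2≤t → ¬ IsStrictVectorColoring G t p
    slack⇒¬strict 2≤t i∼j slack col = <.irrefl (IsStrictVectorColoring.tight col i∼j) slack

    slack⇒χᵥ<χₛᵥ : UniquelyVectorColorable G → ∀ {d} {p : Fin n → ℝ^ d} → IsOptimal G p →
                   ∀ {t} → t Isχᵥ G → (2≤t : 2# ≤ t) → ∀ {i j} → Adj G i j →
                   ⟨ p i , p j ⟩ < -1/[ t -1] 2≤t → ∀ {s} → s Isχₛᵥ G → t < s
    slack⇒χᵥ<χₛᵥ uvc {p = p} opt-p {t} t-χᵥ 2≤t {i} {j} i∼j slack {s} s-χₛᵥ@((_ , q , col) , _)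
      -- Strict colorings are colorings, so `t ≤ s`; it remains to refute `t ≈ s`.
      with IsLeast-antitone strictlyColorable⇒colorable t-χᵥ s-χₛᵥ
    ... | inj₁ t<s = t<s
    ... | inj₂ t≈s = contradiction slack (<.irrefl tight-p)
      where
      module q = IsStrictVectorColoring col

      -- Since `s ≈ t`, the strict coloring `q` attains the vector chromatic number, which puts it
      -- within reach of uniqueness.
      opt-q : IsOptimal G q
      opt-q = record
        { χᵥ               = s
        ; isχᵥ             = IsLeast-resp-≈ t≈s (_ , q , q.isVectorColoring) t-χᵥ
        ; isVectorColoring = q.isVectorColoring
        }

      tight-p : ⟨ p i , p j ⟩ ≈ -1/[ t -1] 2≤t
      -- Uniqueness moves the entry from `p` to `q`, tightness of `q` evaluates it at `s`, and
      -- congruence of the threshold replaces `s` by `t`.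
      tight-p = trans (uvc p q opt-p opt-q i j)
                (trans (q.tight i∼j) (-1/[-1]-cong q.2≤t 2≤t (sym t≈s)))

theorem3p12 : ∀ {c ℓ₁ ℓ₂ a b} (ℝ : RealNumbers c ℓ₁ ℓ₂) →
  let open RealNumbers ℝ
      open VectorColoring ℝ in
  ∀ {n : ℕ} (H : Graph n a) {d : ℕ} (p : Fin n → ℝ^ d) (opt : IsOptimal H p) (G : Graph n b) →
  H ⊆ G → G ⊆ (H ′[ opt ]) →
  (IsOptimal G p × (∀ {s t} → s Isχᵥ H → t Isχᵥ G → s ≈ t))
  ×
  (UniquelyVectorColorable H →
    UniquelyVectorColorable G
    × (∀ {e : ℕ} (q : Fin n → ℝ^ e) → IsOptimal G q → p ≈Gram q)
    × (∀ {t} → t Isχᵥ G → (2≤t : 2# ≤ t) →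
        (∃₂ λ i j → Adj G i j × ⟨ p i , p j ⟩ < -1/[ t -1] 2≤t) →
        ¬ IsStrictVectorColoring G t p
        × (∀ {s} → s Isχₛᵥ G → t < s)))
theorem3p12 ℝ H p opt G H⊆G G⊆H′ =
  (opt-p , χᵥ-unchanged H⊆G opt G⊆H′) ,
  λ uvc →
    let uvc-G = restrict-unique H⊆G opt G⊆H′ uvc in
    uvc-G ,
    (λ q opt-q → uvc-G p q opt-p opt-q) ,
    λ t-χᵥ 2≤t (i , j , i∼j , slack) →
      slack⇒¬strict 2≤t i∼j slack , slack⇒χᵥ<χₛᵥ uvc-G opt-p t-χᵥ 2≤t i∼j slack
  where
  open VectorColoring ℝ
  open VectorColoringProperties ℝ
  opt-p : IsOptimal G p
  opt-p = extend-isOptimal H⊆G opt G⊆H′
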